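{- Let $K(\mathcal{M})$ be a Kripke model with classical domains such that there are $v, w \in K$ with $v < w$. If $a, b \in \mathcal{M}_v$ and $g : a \to b$ is a function contained in $\mathcal{M}_w$ but not in $\mathcal{M}_v$, then $K(\mathcal{M}) \not\Vdash \mathsf{Exp}$.
   Context: A Kripke frame $(K,\leq)$ is a set $K$ with a partial order $\leq$. A sound assignment for $K$ is a map $v \mapsto \mathcal{M}_v$ assigning to every node $v \in K$ a transitive model $\mathcal{M}_v$ of $\mathsf{ZF}$ such that, for $v \leq w$, $\mathcal{M}_v \subseteq \mathcal{M}_w$ and membership and equality statements true in $\mathcal{M}_v$ remain true in $\mathcal{M}_w$. The Kripke model with classical domains $K(\mathcal{M})$ has underlying frame $(K,\leq)$, domain $\mathcal{M}_v$ at node $v$, and membership relation at $v$ the restriction of $\in$ to $\mathcal{M}_v$. Forcing for formulas of the language of set theory with parameters in $\mathcal{M}_v$: $v \Vdash a \in b$ iff $a \in b$; $v \Vdash a = b$ iff $a = b$; $\wedge$ and $\vee$ are evaluated pointwise at $v$; $v \Vdash \varphi \rightarrow \psi$ iff for all $w \geq v$, $w \Vdash \varphi$ implies $w \Vdash \psi$; $v \Vdash \bot$ never; $v \Vdash \exists x\, \varphi(x)$ iff $v \Vdash \varphi(a)$ for some $a \in \mathcal{M}_v$; $v \Vdash \forall x\, \varphi(x)$ iff for all $w \geq v$ and all $a \in \mathcal{M}_w$, $w \Vdash \varphi(a)$. $K(\mathcal{M}) \Vdash \varphi$ means $v \Vdash \varphi$ for all $v \in K$. The axiom of exponentiation $\mathsf{Exp}$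 is $\forall x\, \forall y\, \exists z\, \forall f\, (f \in z \leftrightarrow f : x \to y)$, where $f : x \to y$ abbreviates the $\Delta_0$-formula stating that $f$ is a function from $x$ to $y$. -}

module Defs where

open import Level using (Level; Lift; lift; suc; _⊔_)
open import Data.Bool.Base using (Bool; true; false)
open import Data.Empty.Polymorphic using (⊥)
open import Data.Fin.Base using (Fin; zero; _↑ʳ_)
  renaming (suc to fsuc)
open import Data.Fin.Patterns using (0F; 1F; 2F; 3F)
open import Data.Nat.Base using (ℕ; _+_)
  renaming (suc to nsuc)
open import Data.Product.Base using (Σ; ∃; _×_; _,_; proj₁)
open import Data.Sum.Base using (_⊎_)
open import Data.Vec.Base using (Vec; []; _∷_; lookup; map)
open import Relation.Binary.Bundles using (Poset)
open import Relation.Binary.Definitions using (_Respects_)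
open import Relation.Unary using (Pred)

private
  variable
    a ℓ m c ℓ₁ ℓ₂ : Level
    n k : ℕ

------------------------------------------------------------------------
-- The ambient universe of sets: Aczel's cumulative hierarchy, in which
-- equality of sets is bisimilarity.

data V ℓ : Set (suc ℓ) where
  sup : (A : Set ℓ) → (A → V ℓ) → V ℓ

infix 4 _≈_ _∈_

_≈_ : V ℓ → V ℓ → Set ℓ
sup A f ≈ sup B g =
  (∀ i → Σ B λ j → f i ≈ g j) × (∀ j → Σ A λ i → f i ≈ g j)

_∈_ : V ℓ → V ℓ → Set ℓ
x ∈ sup B g = Σ B λ j → x ≈ g j

｛_,_｝ : V ℓ → V ℓ → V ℓ
｛_,_｝ {ℓ} x y = sup (Lift ℓ Bool) λ where
  (lift false) → x
  (lift true)  → y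

⟨_,_⟩ : V ℓ → V ℓ → V ℓ
⟨ x , y ⟩ = ｛ ｛ x , x ｝ , ｛ x , y ｝ ｝

infix 4 _∶_⟶_

record _∶_⟶_ (g a b : V ℓ) : Set (suc ℓ) where
  field
    relation   : ∀ p → p ∈ g → ∃ λ s → ∃ λ t → s ∈ a × t ∈ b × p ≈ ⟨ s , t ⟩
    total      : ∀ s → s ∈ a → ∃ λ t → t ∈ b × ⟨ s , t ⟩ ∈ g
    functional : ∀ s t t′ → ⟨ s , t ⟩ ∈ g → ⟨ s , t′ ⟩ ∈ g → t ≈ t′

------------------------------------------------------------------------
-- First-order formulas of the language of set theory, with free
-- variables in Fin n (de Bruijn indices; a quantifier binds index 0).

infix  12 _∈̇_ _≐_
infixr 11 ¬̇_
infixr 10 _∧̇_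
infixr 9  _∨̇_
infixr 8  _⇒̇_
infix  8  _⇔̇_
infixr 7  ∀̇_ ∃̇_

data Formula (n : ℕ) : Set where
  _∈̇_ _≐_        : Fin n → Fin n → Formula n
  ⊥̇              : Formula n
  _∧̇_ _∨̇_ _⇒̇_ : Formula n → Formula n → Formula n
  ∀̇_ ∃̇_        : Formula (nsuc n) → Formula n

¬̇_ : Formula n → Formula n
¬̇ φ = φ ⇒̇ ⊥̇

_⇔̇_ : Formula n → Formula n → Formula n
φ ⇔̇ ψ = (φ ⇒̇ ψ) ∧̇ (ψ ⇒̇ φ)

∀∈ ∃∈ : Fin n → Formula (nsuc n) → Formula n
∀∈ x φ = ∀̇ zero ∈̇ fsuc x ⇒̇ φ
∃∈ x φ = ∃̇ zero ∈̇ fsuc x ∧̇ φ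

lift-renaming : (Fin n → Fin k) → Fin (nsuc n) → Fin (nsuc k)
lift-renaming r zero     = zero
lift-renaming r (fsuc i) = fsuc (r i)

rename : (Fin n → Fin k) → Formula n → Formula k
rename r (x ∈̇ y)  = r x ∈̇ r y
rename r (x ≐ y)   = r x ≐ r y
rename r ⊥̇        = ⊥̇
rename r (φ ∧̇ ψ) = rename r φ ∧̇ rename r ψ
rename r (φ ∨̇ ψ) = rename r φ ∨̇ rename r ψ
rename r (φ ⇒̇ ψ) = rename r φ ⇒̇ rename r ψ
rename r (∀̇ φ)    = ∀̇ rename (lift-renaming r) φ
rename r (∃̇ φ)    = ∃̇ rename (lift-renaming r) φ

-- u = {x , y}
isUPair : (u x y : Fin n) → Formula n
isUPair u x y = x ∈̇ u ∧̇ y ∈̇ u ∧̇ ∀∈ u (0F ≐ fsuc x ∨̇ 0F ≐ fsuc y)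

-- p = {{x , x} , {x , y}}
isPair : (p x y : Fin n) → Formula n
isPair p x y =
    ∃∈ p (isUPair 0F (fsuc x) (fsuc x))
  ∧̇ ∃∈ p (isUPair 0F (fsuc x) (fsuc y))
  ∧̇ ∀∈ p (isUPair 0F (fsuc x) (fsuc x) ∨̇ isUPair 0F (fsuc x) (fsuc y))

-- ⟨ s , t ⟩ ∈ f
pairIn : (s t f : Fin n) → Formula n
pairIn s t f = ∃∈ f (isPair 0F (fsuc s) (fsuc t))

isFunction : (f x y : Fin n) → Formula n
isFunction f x y =
    ∀∈ f (∃∈ (1 ↑ʳ x) (∃∈ (2 ↑ʳ y) (isPair 2F 1F 0F)))
  ∧̇ ∀∈ x (∃∈ (1 ↑ʳ y) (pairIn 1F 0F (2 ↑ʳ f)))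
  ∧̇ ∀∈ x (∀∈ (1 ↑ʳ y) (∀∈ (2 ↑ʳ y)
      (pairIn 2F 1F (3 ↑ʳ f) ∧̇ pairIn 2F 0F (3 ↑ʳ f) ⇒̇ 1F ≐ 0F)))

-- ∀ x ∀ y ∃ z ∀ f (f ∈ z ↔ f : x → y)
Exp : Formula 0
Exp = ∀̇ ∀̇ ∃̇ ∀̇ (0F ∈̇ 1F ⇔̇ isFunction 0F 3F 2F)

------------------------------------------------------------------------
-- ZF. The parameters of the two schemas are left free; a formula holds in
-- a model when it holds under all assignments.

isEmpty : Fin n → Formula n
isEmpty x = ∀∈ x ⊥̇

-- y = x ∪ {x}
isSuccessor : (y x : Fin n) → Formula n
isSuccessor y x =
  ∀∈ x (0F ∈̇ fsuc y) ∧̇ x ∈̇ y ∧̇ ∀∈ y (0F ∈̇ fsuc x ∨̇ 0F ≐ fsuc x)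

-- In φ (x , parameters), inserts two bound variables after x.
skip₂ : Formula (1 + n) → Formula (3 + n)
skip₂ = rename λ where
  zero     → zero
  (fsuc i) → 3 ↑ʳ i

extensionality pairing union powerset infinity foundation : Formula 0
extensionality = ∀̇ ∀̇ (∀̇ (0F ∈̇ 2F ⇔̇ 0F ∈̇ 1F)) ⇒̇ 1F ≐ 0F
pairing        = ∀̇ ∀̇ ∃̇ ∀̇ (0F ∈̇ 1F ⇔̇ (0F ≐ 3F ∨̇ 0F ≐ 2F))
union          = ∀̇ ∃̇ ∀̇ (0F ∈̇ 1F ⇔̇ ∃∈ 2F (1F ∈̇ 0F))
powerset       = ∀̇ ∃̇ ∀̇ (0F ∈̇ 1F ⇔̇ ∀∈ 0F (0F ∈̇ 3F))
infinity       = ∃̇ ∃∈ 0F (isEmpty 0F) ∧̇ ∀∈ 0F (∃∈ 1F (isSuccessor 0F 1F))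
foundation     = ∀̇ (∃̇ 0F ∈̇ 1F) ⇒̇ ∃∈ 0F (∀∈ 0F (¬̇ 0F ∈̇ 2F))

-- ∀ u ∃ v ∀ x (x ∈ v ↔ x ∈ u ∧ φ (x , parameters))
separation : Formula (1 + n) → Formula n
separation φ = ∀̇ ∃̇ ∀̇ (0F ∈̇ 1F ⇔̇ (0F ∈̇ 2F ∧̇ skip₂ φ))

-- ∀ x ∀ y ∀ z (φ (x , y) ∧ φ (x , z) → y = z)
--   → ∀ u ∃ v ∀ y (y ∈ v ↔ ∃ x ∈ u. φ (x , y)),
-- where φ has x at index 0, y at index 1, and the parameters above them.
replacement : Formula (2 + n) → Formula n
replacement {n} φ =
    (∀̇ ∀̇ ∀̇ rename φxy φ ∧̇ rename φxz φ ⇒̇ 1F ≐ 0F)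
  ⇒̇ (∀̇ ∃̇ ∀̇ (0F ∈̇ 1F ⇔̇ ∃∈ 2F (rename φ-image φ)))
  where
  φxy φxz : Fin (2 + n) → Fin (3 + n)
  φxy 0F              = 2F
  φxy 1F              = 1F
  φxy (fsuc (fsuc i)) = 3 ↑ʳ i
  φxz 0F              = 2F
  φxz 1F              = 0F
  φxz (fsuc (fsuc i)) = 3 ↑ʳ i

  φ-image : Fin (2 + n) → Fin (4 + n)
  φ-image 0F              = 0F
  φ-image 1F              = 1F
  φ-image (fsuc (fsuc i)) = 4 ↑ʳ i

data ZF : Formula n → Set where
  ext   : ZF extensionality
  pair  : ZF pairing
  un    : ZF union
  pow   : ZF powerset
  inf   : ZF infinity
  found : ZF foundation
  sep   : (φ : Formula (1 + n)) → ZF (separation φ)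
  repl  : (φ : Formula (2 + n)) → ZF (replacement φ)

------------------------------------------------------------------------
-- A class M of sets is a predicate on V, and the elements of the structure
-- (M , ∈) are the members of V satisfying it. Satisfaction is Tarskian; no
-- excluded middle is imposed, because foundation (in the form of ∈-minimal
-- elements) together with separation and pairing already forces every
-- instance of it to hold in a model of ZF.

Dom : Pred (V ℓ) m → Set (suc ℓ ⊔ m)
Dom M = ∃ M

infix 4 _⊨_[_]

_⊨_[_] : (M : Pred (V ℓ) m) → Formula n → Vec (Dom M) n → Set (suc ℓ ⊔ m)
_⊨_[_] {ℓ} {m} M (x ∈̇ y) ρ =
  Lift (suc ℓ ⊔ m) (proj₁ (lookup ρ x) ∈ proj₁ (lookup ρ y))
_⊨_[_] {ℓ} {m} M (x ≐ y) ρ =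
  Lift (suc ℓ ⊔ m) (proj₁ (lookup ρ x) ≈ proj₁ (lookup ρ y))
M ⊨ ⊥̇ [ ρ ]      = ⊥
M ⊨ φ ∧̇ ψ [ ρ ] = M ⊨ φ [ ρ ] × M ⊨ ψ [ ρ ]
M ⊨ φ ∨̇ ψ [ ρ ] = M ⊨ φ [ ρ ] ⊎ M ⊨ ψ [ ρ ]
M ⊨ φ ⇒̇ ψ [ ρ ] = M ⊨ φ [ ρ ] → M ⊨ ψ [ ρ ]
M ⊨ ∀̇ φ [ ρ ]    = (x : Dom M) → M ⊨ φ [ x ∷ ρ ]
M ⊨ ∃̇ φ [ ρ ]    = Σ (Dom M) λ x → M ⊨ φ [ x ∷ ρ ]

record IsTransitiveModelOfZF (M : Pred (V ℓ) m) : Set (suc ℓ ⊔ m) where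
  field
    respects   : M Respects _≈_
    transitive : ∀ {x y} → M x → y ∈ x → M y
    models-ZF  : ∀ {n} {φ : Formula n} → ZF φ → ∀ ρ → M ⊨ φ [ ρ ]

------------------------------------------------------------------------

record SoundAssignment (F : Poset c ℓ₁ ℓ₂) (ℓ m : Level)
                       : Set (c ⊔ ℓ₂ ⊔ suc (ℓ ⊔ m)) where
  open Poset F using (_≤_) renaming (Carrier to K)
  field
    M                     : K → Pred (V ℓ) m
    isTransitiveModelOfZF : ∀ v → IsTransitiveModelOfZF (M v)
    M-mono                : ∀ {v w} → v ≤ w → ∀ {x} → M v x → M w x

  restrict : ∀ {v w} → v ≤ w → Dom (M v) → Dom (M w)
  restrict v≤w (x , Mx) = x , M-mono v≤w Mx

  field
    ∈-persistent : ∀ {v w} (v≤w : v ≤ w) (x y : Dom (M v)) →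
      M v ⊨ 0F ∈̇ 1F [ x ∷ y ∷ [] ] →
      M w ⊨ 0F ∈̇ 1F [ restrict v≤w x ∷ restrict v≤w y ∷ [] ]
    ≈-persistent : ∀ {v w} (v≤w : v ≤ w) (x y : Dom (M v)) →
      M v ⊨ 0F ≐ 1F [ x ∷ y ∷ [] ] →
      M w ⊨ 0F ≐ 1F [ restrict v≤w x ∷ restrict v≤w y ∷ [] ]

module KripkeModel {F : Poset c ℓ₁ ℓ₂} (𝓜 : SoundAssignment F ℓ m) where
  open Poset F using (_≤_) renaming (Carrier to K)
  open SoundAssignment 𝓜

  infix 4 _⊩_[_]

  _⊩_[_] : (v : K) → Formula n → Vec (Dom (M v)) n → Set (c ⊔ ℓ₂ ⊔ suc ℓ ⊔ m)
  v ⊩ x ∈̇ y [ ρ ] =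
    Lift (c ⊔ ℓ₂ ⊔ suc ℓ ⊔ m) (proj₁ (lookup ρ x) ∈ proj₁ (lookup ρ y))
  v ⊩ x ≐ y [ ρ ] =
    Lift (c ⊔ ℓ₂ ⊔ suc ℓ ⊔ m) (proj₁ (lookup ρ x) ≈ proj₁ (lookup ρ y))
  v ⊩ ⊥̇ [ ρ ]      = ⊥
  v ⊩ φ ∧̇ ψ [ ρ ] = v ⊩ φ [ ρ ] × v ⊩ ψ [ ρ ]
  v ⊩ φ ∨̇ ψ [ ρ ] = v ⊩ φ [ ρ ] ⊎ v ⊩ ψ [ ρ ]
  v ⊩ φ ⇒̇ ψ [ ρ ] = ∀ {w} (v≤w : v ≤ w) →
    w ⊩ φ [ map (restrict v≤w) ρ ] → w ⊩ ψ [ map (restrict v≤w) ρ ]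
  v ⊩ ∃̇ φ [ ρ ]    = Σ (Dom (M v)) λ x → v ⊩ φ [ x ∷ ρ ]
  v ⊩ ∀̇ φ [ ρ ]    = ∀ {w} (v≤w : v ≤ w) (x : Dom (M w)) →
    w ⊩ φ [ x ∷ map (restrict v≤w) ρ ]

infix 4 _⊩_

_⊩_ : {F : Poset c ℓ₁ ℓ₂} → SoundAssignment F ℓ m → Formula 0 →
      Set (c ⊔ ℓ₂ ⊔ suc ℓ ⊔ m)
_⊩_ {F = F} 𝓜 φ = (v : Poset.Carrier F) → v ⊩ φ [ [] ]
  where open KripkeModel 𝓜 using (_⊩_[_])

{-# OPTIONS --safe #-}
-- Being a function is a Δ₀ property, and the models are transitive, so every
-- node above w whose model contains g, a and b forces "g : a → b".  If Exp held
-- at v, the exponent z of a and b would lie in M v and, evaluated at w, would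
-- contain g; transitivity of M v would then put g into M v.
module Submission where

open import Defs
open import Level using (Level; lift; lower)
open import Data.Bool.Base using (true; false)
open import Data.Fin.Base using (Fin) renaming (suc to fsuc)
open import Data.Fin.Patterns using (0F; 1F; 2F; 3F)
open import Data.Nat.Base using (ℕ)
open import Data.Product.Base using (∃; _×_; _,_; proj₁; proj₂)
open import Data.Sum.Base using (_⊎_; inj₁; inj₂; [_,_]′)
import Data.Sum.Base as Sum
open import Data.Vec.Base using (Vec; []; _∷_; lookup; map)
open import Data.Vec.Properties using (lookup-map)
open import Function.Base using (_∘_)
open import Relation.Binary.Bundles using (Poset)
open import Relation.Binary.Properties.Poset using (_<_)
open import Relation.Binary.PropositionalEquality
  using (_≡_; cong; trans; sym; subst; subst₂)
open import Relation.Nullary using (¬_)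

private
  variable
    c ℓ ℓ₁ ℓ₂ m : Level
    n : ℕ

≈-refl : (x : V ℓ) → x ≈ x
≈-refl (sup A f) = (λ i → i , ≈-refl (f i)) , (λ i → i , ≈-refl (f i))

≈-sym : (x y : V ℓ) → x ≈ y → y ≈ x
≈-sym (sup A f) (sup B g) (to , from) =
    (λ j → proj₁ (from j) , ≈-sym (f _) (g j) (proj₂ (from j)))
  , (λ i → proj₁ (to i) , ≈-sym (f i) (g _) (proj₂ (to i)))

≈-trans : (x y z : V ℓ) → x ≈ y → y ≈ z → x ≈ z
≈-trans (sup A f) (sup B g) (sup C h) (to , from) (to′ , from′) =
    (λ i → let j , p = to i ; k , q = to′ j in k , ≈-trans (f i) (g j) (h k) p q)
  , (λ k → let j , q = from′ k ; i , p = from j in i , ≈-trans (f i) (g j) (h k) p q)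

∈-respˡ-≈ : ∀ {x y : V ℓ} z → x ≈ y → x ∈ z → y ∈ z
∈-respˡ-≈ {x = x} {y} (sup A f) x≈y (i , x≈fi) =
  i , ≈-trans y x (f i) (≈-sym x y x≈y) x≈fi

∈-respʳ-≈ : ∀ (z x y : V ℓ) → x ≈ y → z ∈ x → z ∈ y
∈-respʳ-≈ z (sup A f) (sup B g) (to , _) (i , z≈fi) =
  let j , fi≈gj = to i in j , ≈-trans z (f i) (g j) z≈fi fi≈gj

-- Each branch of a tree is one of its members, so applying the two inclusions to branches gives
-- both halves of the bisimulation.
≈-extensional : (x y : V ℓ) → (∀ e → e ∈ x → e ∈ y) → (∀ e → e ∈ y → e ∈ x) → x ≈ y
≈-extensional (sup A f) (sup B g) x⊆y y⊆x =
    (λ i → x⊆y (f i) (i , ≈-refl (f i)))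
  , (λ j → let i , gj≈fi = y⊆x (g j) (j , ≈-refl (g j)) in
      i , ≈-sym (g j) (f i) gj≈fi)

∈-pair⁺ : ∀ {e x y : V ℓ} → e ≈ x ⊎ e ≈ y → e ∈ ｛ x , y ｝
∈-pair⁺ (inj₁ e≈x) = lift false , e≈x
∈-pair⁺ (inj₂ e≈y) = lift true  , e≈y

∈-pair⁻ : ∀ {e x y : V ℓ} → e ∈ ｛ x , y ｝ → e ≈ x ⊎ e ≈ y
∈-pair⁻ (lift false , e≈x) = inj₁ e≈x
∈-pair⁻ (lift true  , e≈y) = inj₂ e≈y

-- The content of the formula `isUPair`, read in `V`. It serves both levels of a Kuratowski pair,
-- which is an unordered pair of unordered pairs.
IsUPair : (u x y : V ℓ) → Set _
IsUPair u x y = x ∈ u × y ∈ u × (∀ e → e ∈ u → e ≈ x ⊎ e ≈ y)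

IsUPair⇒≈ : ∀ {u x y : V ℓ} → IsUPair u x y → u ≈ ｛ x , y ｝
IsUPair⇒≈ {u = u} {x} {y} (x∈u , y∈u , only) =
  ≈-extensional u ｛ x , y ｝ (λ e → ∈-pair⁺ ∘ only e)
    (λ e → [ (λ e≈x → ∈-respˡ-≈ u (≈-sym e x e≈x) x∈u)
           , (λ e≈y → ∈-respˡ-≈ u (≈-sym e y e≈y) y∈u) ]′ ∘ ∈-pair⁻)

≈⇒IsUPair : ∀ {u x y : V ℓ} → u ≈ ｛ x , y ｝ → IsUPair u x y
≈⇒IsUPair {u = u} {x} {y} u≈xy =
    back x (inj₁ (≈-refl x))
  , back y (inj₂ (≈-refl y))
  , λ e → ∈-pair⁻ ∘ ∈-respʳ-≈ e u ｛ x , y ｝ u≈xy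
  where
  back : ∀ e → e ≈ x ⊎ e ≈ y → e ∈ u
  back e = ∈-respʳ-≈ e ｛ x , y ｝ u (≈-sym u ｛ x , y ｝ u≈xy) ∘ ∈-pair⁺

module Forcing {F : Poset c ℓ₁ ℓ₂} (𝓜 : SoundAssignment F ℓ m) where
  open Poset F using (_≤_) renaming (Carrier to K; refl to ≤-refl)
  open SoundAssignment 𝓜
  open KripkeModel 𝓜

  private
    variable
      v w u : K

  -- Every appeal to transitivity passes through here: it turns members found in `V` into elements
  -- of the domain, which is what makes bounded quantifiers absolute.
  element : (x : Dom (M v)) {y : V ℓ} → y ∈ proj₁ x → Dom (M v)
  element {v = v} (x , Mx) {y} y∈x =
    y , IsTransitiveModelOfZF.transitive (isTransitiveModelOfZF v) Mx y∈x

  value : Vec (Dom (M v)) n → Fin n → V ℓ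
  value ρ i = proj₁ (lookup ρ i)

  -- `restrict` keeps the underlying set, but for an abstract `ρ` the composite of `lookup` and
  -- `map` does not reduce, so the equation has to be transported along.
  value-restrict : (v≤w : v ≤ w) (ρ : Vec (Dom (M v)) n) (i : Fin n) →
    value (map (restrict v≤w) ρ) i ≡ value ρ i
  value-restrict v≤w ρ i = cong proj₁ (lookup-map i (restrict v≤w) ρ)

  -- A bounded universal quantifier passes to a later node twice, once for ∀̇
  -- and once for ⇒̇.
  restrict² : v ≤ w → w ≤ u → Vec (Dom (M v)) n → Vec (Dom (M u)) n
  restrict² v≤w w≤u ρ = map (restrict w≤u) (map (restrict v≤w) ρ)

  value-restrict² : (v≤w : v ≤ w) (w≤u : w ≤ u) (ρ : Vec (Dom (M v)) n) (i : Fin n) →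
    value (restrict² v≤w w≤u ρ) i ≡ value ρ i
  value-restrict² v≤w w≤u ρ i =
    trans (value-restrict w≤u (map (restrict v≤w) ρ) i) (value-restrict v≤w ρ i)

  -- The third conjunct of `IsUPair` speaks of all sets in `V`, so it covers the members supplied by
  -- the domain of any later node.
  isUPair⁺ : (ρ : Vec (Dom (M v)) n) (p x y : Fin n) →
    value ρ p ≈ ｛ value ρ x , value ρ y ｝ → v ⊩ isUPair p x y [ ρ ]
  isUPair⁺ ρ p x y p≈xy = let x∈p , y∈p , only = ≈⇒IsUPair p≈xy in
      lift x∈p
    , lift y∈p
    , λ v≤w e w≤u (lift e∈p) →
        let eq = value-restrict² v≤w w≤u ρ in
        Sum.map (lift ∘ subst (proj₁ e ≈_) (sym (eq x)))
                (lift ∘ subst (proj₁ e ≈_) (sym (eq y)))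
                (only (proj₁ e) (subst (proj₁ e ∈_) (eq p) e∈p))

  isUPair⁻ : (ρ : Vec (Dom (M v)) n) (p x y : Fin n) →
    v ⊩ isUPair p x y [ ρ ] → value ρ p ≈ ｛ value ρ x , value ρ y ｝
  isUPair⁻ ρ p x y (lift x∈p , lift y∈p , only) = IsUPair⇒≈
    ( x∈p
    , y∈p
    , λ e e∈p →
        let eq = value-restrict² ≤-refl ≤-refl ρ in
        Sum.map (subst (e ≈_) (eq x) ∘ lower)
                (subst (e ≈_) (eq y) ∘ lower)
                -- The forced clause is instantiated at the current node, whose domain already has
                -- every member of `p`.
                (only ≤-refl (element (lookup ρ p) e∈p) ≤-refl
                  (lift (subst (e ∈_) (sym (eq p)) e∈p))))

  isPair⁺ : (ρ : Vec (Dom (M v)) n) (p x y : Fin n) →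
    value ρ p ≈ ⟨ value ρ x , value ρ y ⟩ → v ⊩ isPair p x y [ ρ ]
  isPair⁺ ρ p x y p≈xy = let xx∈p , xy∈p , only = ≈⇒IsUPair p≈xy in
      component x xx∈p
    , component y xy∈p
    , λ v≤w e w≤u (lift e∈p) →
        let eq = value-restrict² v≤w w≤u ρ
            ρ′ = restrict w≤u e ∷ restrict² v≤w w≤u ρ
            intro : ∀ z → proj₁ e ≈ ｛ value ρ x , value ρ z ｝ →
                    _ ⊩ isUPair 0F (fsuc x) (fsuc z) [ ρ′ ]
            intro z = isUPair⁺ ρ′ 0F (fsuc x) (fsuc z)
              ∘ subst₂ (λ s t → proj₁ e ≈ ｛ s , t ｝) (sym (eq x)) (sym (eq z))
        in
        Sum.map (intro x) (intro y) (only (proj₁ e) (subst (proj₁ e ∈_) (eq p) e∈p))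
    where
    component : ∀ z → ｛ value ρ x , value ρ z ｝ ∈ value ρ p →
      _ ⊩ ∃∈ p (isUPair 0F (fsuc x) (fsuc z)) [ ρ ]
    component z xz∈p = let e = element (lookup ρ p) xz∈p in
      -- The witness is the set `｛ x , z ｝` itself, which is in the domain because it is a member of
      -- `p`.
      e , lift xz∈p , isUPair⁺ (e ∷ ρ) 0F (fsuc x) (fsuc z) (≈-refl (proj₁ e))

  isPair⁻ : (ρ : Vec (Dom (M v)) n) (p x y : Fin n) →
    v ⊩ isPair p x y [ ρ ] → value ρ p ≈ ⟨ value ρ x , value ρ y ⟩
  isPair⁻ ρ p x y (xx , xy , only) = IsUPair⇒≈
    ( component x xx
    , component y xy
    , λ e e∈p →
        let eq = value-restrict² ≤-refl ≤-refl ρ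
            e′ = element (lookup ρ p) e∈p
            ρ′ = restrict ≤-refl e′ ∷ restrict² ≤-refl ≤-refl ρ
            elim : ∀ z → _ ⊩ isUPair 0F (fsuc x) (fsuc z) [ ρ′ ] →
                   e ≈ ｛ value ρ x , value ρ z ｝
            elim z = subst₂ (λ s t → e ≈ ｛ s , t ｝) (eq x) (eq z)
              ∘ isUPair⁻ ρ′ 0F (fsuc x) (fsuc z)
        in
        Sum.map (elim x) (elim y)
          (only ≤-refl e′ ≤-refl
            (lift (subst (e ∈_) (sym (eq p)) e∈p))))
    where
    component : ∀ z → _ ⊩ ∃∈ p (isUPair 0F (fsuc x) (fsuc z)) [ ρ ] →
      ｛ value ρ x , value ρ z ｝ ∈ value ρ p
    component z (e , lift e∈p , e-upair) =
      ∈-respˡ-≈ (value ρ p) (isUPair⁻ (e ∷ ρ) 0F (fsuc x) (fsuc z) e-upair) e∈p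

  pairIn⁺ : (ρ : Vec (Dom (M v)) n) (s t f : Fin n) →
    ⟨ value ρ s , value ρ t ⟩ ∈ value ρ f → v ⊩ pairIn s t f [ ρ ]
  pairIn⁺ ρ s t f st∈f = let p = element (lookup ρ f) st∈f in
    p , lift st∈f , isPair⁺ (p ∷ ρ) 0F (fsuc s) (fsuc t) (≈-refl (proj₁ p))

  pairIn⁻ : (ρ : Vec (Dom (M v)) n) (s t f : Fin n) →
    v ⊩ pairIn s t f [ ρ ] → ⟨ value ρ s , value ρ t ⟩ ∈ value ρ f
  pairIn⁻ ρ s t f (p , lift p∈f , p-pair) =
    ∈-respˡ-≈ (value ρ f) (isPair⁻ (p ∷ ρ) 0F (fsuc s) (fsuc t) p-pair) p∈f

  -- The explicit environment (with the exponent z unused) makes all values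
  -- compute, so that no transport along value-restrict is needed.
  isFunction⁺ : (g z b a : Dom (M v)) → proj₁ g ∶ proj₁ a ⟶ proj₁ b →
    v ⊩ isFunction 0F 3F 2F [ g ∷ z ∷ b ∷ a ∷ [] ]
  isFunction⁺ g z b a g-function =
      (λ v≤w p w≤u (lift p∈g) →
        let s , t , s∈a , t∈b , p≈st = relation (proj₁ p) p∈g
            s′ = element (restrict w≤u (restrict v≤w a)) s∈a
            t′ = element (restrict w≤u (restrict v≤w b)) t∈b
        in s′ , lift s∈a , t′ , lift t∈b
         , isPair⁺ (t′ ∷ s′ ∷ restrict w≤u p ∷ restrict² v≤w w≤u ρ) 2F 1F 0F p≈st)
    , (λ v≤w s w≤u (lift s∈a) →
        let t , t∈b , st∈g = total (proj₁ s) s∈a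
            t′ = element (restrict w≤u (restrict v≤w b)) t∈b
        in t′ , lift t∈b , pairIn⁺ (t′ ∷ restrict w≤u s ∷ restrict² v≤w w≤u ρ) 1F 0F 2F st∈g)
    -- Each of the three bounded quantifiers moves up twice (`pᵢ`, `qᵢ`), and the implication once
    -- more (`r`). Here `pairIn` stands left of an arrow, which is why the converse lemmas were
    -- proved.
    , λ p₀ s q₀ _ p₁ t q₁ _ p₂ t′ q₂ _ r (st , st′) →
        let ρ₀ = restrict q₀ s  ∷ restrict² p₀ q₀ ρ
            ρ₁ = restrict q₁ t  ∷ restrict² p₁ q₁ ρ₀
            ρ₂ = restrict q₂ t′ ∷ restrict² p₂ q₂ ρ₁
            ρ₃ = map (restrict r) ρ₂
        in lift (functional (proj₁ s) (proj₁ t) (proj₁ t′)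
                  (pairIn⁻ ρ₃ 2F 1F 3F st) (pairIn⁻ ρ₃ 2F 0F 3F st′))
    where
    open _∶_⟶_ g-function
    ρ = g ∷ z ∷ b ∷ a ∷ []

  exponent-contains : (a b : Dom (M v)) (v≤w : v ≤ w) (g : Dom (M w)) →
    proj₁ g ∶ proj₁ a ⟶ proj₁ b → v ⊩ Exp [ [] ] →
    ∃ λ (z : Dom (M v)) → proj₁ g ∈ proj₁ z
  exponent-contains a b v≤w g g-function exp =
    -- Both outer quantifiers are instantiated at `v` itself, so that `z` is chosen in `M v`; the
    -- quantifier over `f` then moves to `w`, where `g` is available.
    let z , z-exponent = exp ≤-refl a ≤-refl b
        _ , function⇒∈ = z-exponent v≤w g
        -- `up` follows a parameter through the quantifier over `f` and then the implication. In
        -- addition, `a` is restricted once by the quantifier that introduces `b`.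
        up : Dom (M _) → Dom (M _)
        up = restrict ≤-refl ∘ restrict v≤w
    in z , lower (function⇒∈ ≤-refl
             (isFunction⁺ (restrict ≤-refl g) (up z) (up b)
               (up (restrict ≤-refl a)) g-function))

proposition23 : ∀ {c ℓ₁ ℓ₂ ℓ m : Level} (F : Poset c ℓ₁ ℓ₂) (𝓜 : SoundAssignment F ℓ m) →
    let open SoundAssignment 𝓜 using (M) in
    (v w : Poset.Carrier F) → _<_ F v w →
    (a b g : V ℓ) → M v a → M v b →
    g ∶ a ⟶ b → M w g → ¬ M v g →
    ¬ (𝓜 ⊩ Exp)
proposition23 F 𝓜 v w (v≤w , _) a b g Ma Mb g-function Mg ¬Mg exp =
  let z , g∈z = exponent-contains (a , Ma) (b , Mb) v≤w (g , Mg) g-function (exp v)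
  in ¬Mg (proj₂ (element z g∈z))
  where open Forcing 𝓜
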